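{- Let $p$ be a prime and let $\varGamma(\mathbb{Z}_{p^3})$ be the zero divisor graph of $\mathbb{Z}_{p^3}$. Then the independence polynomial of $\varGamma(\mathbb{Z}_{p^3})$ is $$I(\varGamma(\mathbb{Z}_{p^3}), x) = (1+x)^{p^2-p} + (1+(p-1)x) - 1 = (1+x)^{p^2-p} + (p-1)x.$$
   Context: For a positive integer $n$, the zero divisor graph $\varGamma(\mathbb{Z}_n)$ is the simple undirected graph whose vertices are the non-zero zero divisors of the ring $\mathbb{Z}_n$ of integers modulo $n$ (non-zero $a$ such that $ab=0$ for some non-zero $b$), two distinct vertices $a,b$ being adjacent if and only if $ab=0$ in $\mathbb{Z}_n$. An independent set of a finite graph $G$ is a set of vertices no two of which are adjacent (the empty set included); $\alpha(G)$ is the maximum size of an independent set, and $s_k(G)$ is the number of independent sets of size $k$. The independence polynomial of $G$ is $I(G,x)=\sum_{k=0}^{\alpha(G)} s_k(G)x^k$. -}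

module Defs where

open import Data.Fin using (Fin; toℕ; _≟_)
open import Data.Fin.Properties using (any?; all?)
open import Data.Fin.Subset using (Subset; inside; outside; _∈_; ∣_∣)
open import Data.Fin.Subset.Properties using (_∈?_)
open import Data.Integer as ℤ using (ℤ; 0ℤ; 1ℤ; +_)
open import Data.List using (List; []; _∷_; _++_; map; filter; foldr; length; upTo)
open import Data.List.Extrema.Nat using (max)
open import Data.Nat as ℕ using (ℕ; zero; suc; NonZero)
open import Data.Nat.DivMod using (_mod_)
open import Data.Nat.Properties using (*-comm)
open import Data.Product using (_×_; _,_; proj₁; proj₂; ∃)
open import Data.Vec using ([]; _∷_)
open import Function using (_∘_)
open import Level using (0ℓ)
open import Relation.Binary using (Rel; Symmetric; Irreflexive)
open import Relation.Binary.Definitions renaming (Decidable to Decidable₂) using ()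
open import Relation.Binary.PropositionalEquality
  using (_≡_; _≢_; sym; trans; cong)
open import Relation.Nullary using (¬_)
open import Relation.Nullary.Decidable using (¬?; _×-dec_; _→-dec_)
open import Relation.Unary using (Pred; Decidable)

-- The ambient type Fin n is only a finite supply of labels: the vertex set
-- is { v : Fin n | Vertex v }.
record FiniteGraph (n : ℕ) : Set₁ where
  infix 4 _~_ _~?_
  field
    Vertex   : Pred (Fin n) 0ℓ
    vertex?  : Decidable Vertex
    _~_      : Rel (Fin n) 0ℓ
    _~?_     : Decidable₂ _~_
    ~-vertex : ∀ {a b} → a ~ b → Vertex a × Vertex b
    ~-sym    : Symmetric _~_
    ~-irrefl : Irreflexive _≡_ _~_

subsets : ∀ n → List (Subset n)
subsets zero    = [] ∷ []
subsets (suc n) = map (outside ∷_) (subsets n) ++ map (inside ∷_) (subsets n)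

module _ {n : ℕ} (G : FiniteGraph n) where
  open FiniteGraph G

  Independent : Pred (Subset n) 0ℓ
  Independent S = (∀ a → a ∈ S → Vertex a)
                × (∀ a b → a ∈ S → b ∈ S → ¬ (a ~ b))

  independent? : Decidable Independent
  independent? S =
    all? (λ a → (a ∈? S) →-dec vertex? a)
    ×-dec
    all? (λ a → all? (λ b → (a ∈? S) →-dec ((b ∈? S) →-dec ¬? (a ~? b))))

  independentSets : List (Subset n)
  independentSets = filter independent? (subsets n)

  -- The default value 0 is the size of the empty set, which is independent.
  α : ℕ
  α = max 0 (map ∣_∣ independentSets)

  s : ℕ → ℕ
  s k = length (filter (λ S → ∣ S ∣ ℕ.≟ k) independentSets)

-- Integer polynomials: a₀ ∷ a₁ ∷ … ∷ aₘ ∷ [] stands for a₀ + a₁x + … + aₘxᵐ.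
-- Trailing zeros are allowed, so equality of polynomials is _≈_, not _≡_.
Poly : Set
Poly = List ℤ

coeff : Poly → ℕ → ℤ
coeff []      _       = 0ℤ
coeff (a ∷ _) zero    = a
coeff (_ ∷ f) (suc k) = coeff f k

infix  4 _≈_
infixl 6 _⊕_ _⊖_
infixl 7 _⊗_
infixr 8 _↑_

_≈_ : Rel Poly 0ℓ
f ≈ g = ∀ k → coeff f k ≡ coeff g k

const : ℤ → Poly
const a = a ∷ []

𝟘 𝟙 X : Poly
𝟘 = []
𝟙 = const 1ℤ
X = 0ℤ ∷ 1ℤ ∷ []

_⊕_ : Poly → Poly → Poly
[]      ⊕ g       = g
(a ∷ f) ⊕ []      = a ∷ f
(a ∷ f) ⊕ (b ∷ g) = a ℤ.+ b ∷ f ⊕ g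

_⊖_ : Poly → Poly → Poly
f ⊖ g = f ⊕ map ℤ.-_ g

_⊗_ : Poly → Poly → Poly
[]      ⊗ g = 𝟘
(a ∷ f) ⊗ g = map (a ℤ.*_) g ⊕ (0ℤ ∷ f ⊗ g)

_↑_ : Poly → ℕ → Poly
f ↑ zero  = 𝟙
f ↑ suc m = f ⊗ f ↑ m

-- upTo (suc (α G)) lists 0, 1, …, α G.
independencePolynomial : ∀ {n} → FiniteGraph n → Poly
independencePolynomial G =
  foldr _⊕_ 𝟘 (map (λ k → const (+ s G k) ⊗ X ↑ k) (upTo (suc (α G))))

-- The ring ℤₙ is represented by Fin n, with residues multiplied modulo n.
module _ (n : ℕ) .{{_ : NonZero n}} where

  0ₙ : Fin n
  0ₙ = 0 mod n

  mulₙ : Fin n → Fin n → Fin n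
  mulₙ a b = (toℕ a ℕ.* toℕ b) mod n

  NonZeroZeroDivisor : Pred (Fin n) 0ℓ
  NonZeroZeroDivisor a = a ≢ 0ₙ × ∃ λ b → b ≢ 0ₙ × mulₙ a b ≡ 0ₙ

  nonZeroZeroDivisor? : Decidable NonZeroZeroDivisor
  nonZeroZeroDivisor? a =
    ¬? (a ≟ 0ₙ) ×-dec any? (λ b → ¬? (b ≟ 0ₙ) ×-dec (mulₙ a b ≟ 0ₙ))

  Γ : FiniteGraph n
  Γ = record
    { Vertex   = NonZeroZeroDivisor
    ; vertex?  = nonZeroZeroDivisor?
    ; _~_      = λ a b → (NonZeroZeroDivisor a × NonZeroZeroDivisor b)
                       × a ≢ b × mulₙ a b ≡ 0ₙ
    ; _~?_     = λ a b → (nonZeroZeroDivisor? a ×-dec nonZeroZeroDivisor? b)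
                         ×-dec (¬? (a ≟ b) ×-dec (mulₙ a b ≟ 0ₙ))
    ; ~-vertex = proj₁
    ; ~-sym    = λ {a} {b} ((va , vb) , a≢b , ab≡0) →
                   (vb , va) , a≢b ∘ sym
                 , trans (cong (_mod n) (*-comm (toℕ b) (toℕ a))) ab≡0
    ; ~-irrefl = λ a≡b (_ , a≢b , _) → a≢b a≡b
    }

{-# OPTIONS --safe #-}

-- A multiple of p² annihilates every zero divisor of ℤ_{p³}, whereas two
-- zero divisors not divisible by p² have a product not divisible by p³.
-- So Γ(ℤ_{p³}) is a complete split graph: the p − 1 non-zero multiples of p²
-- form a clique K joined to everything, the p² − p other vertices an
-- independent set Q.  Its independent sets are the subsets of Q and
-- the singletons in K.
module Submission where

open import Defs
open import Data.Bool.Properties using () renaming (_≟_ to _≟ᵇ_)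
open import Data.Fin using (Fin; zero; suc; toℕ; fromℕ<) renaming (_≟_ to _≟ᶠ_)
open import Data.Fin.Properties
  using (any?; all?; toℕ-fromℕ<; toℕ-injective; toℕ<n)
open import Data.Fin.Subset using (Subset; inside; outside; _∈_; ∣_∣; ⁅_⁆)
open import Data.Fin.Subset.Properties
  using (_∈?_; x∈⁅x⁆; x∈⁅y⁆⇒x≡y; ∣⁅x⁆∣≡1; ⊆-antisym)
open import Data.Integer as ℤ using (ℤ; +_; _-_; 0ℤ; 1ℤ)
import Data.Integer.Properties as ℤ
import Data.Integer.Tactic.RingSolver as ℤ-Solver
open import Data.List
  using (List; []; _∷_; _++_; map; filter; foldr; length; upTo; allFin; applyUpTo)
open import Data.List.Extrema.Nat using (xs≤max)
open import Data.List.Membership.Propositional using () renaming (_∈_ to _∈ˡ_)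
open import Data.List.Membership.Propositional.Properties
  using (∈-filter⁺; ∈-filter⁻; ∈-map⁺; ∈-map⁻; ∈-++⁺ˡ; ∈-++⁺ʳ; ∈-upTo⁺; ∈-upTo⁻; ∈-allFin;
         ∈-applyUpTo⁺; ∈-applyUpTo⁻)
open import Data.List.Membership.Propositional.Properties.WithK
  using (unique∧set⇒bag)
open import Data.List.Properties
  using (filter-++; filter-≐; filter-none; filter-accept; filter-reject; length-++;
         length-map; length-applyUpTo; map-tabulate)
open import Data.List.Relation.Binary.BagAndSetEquality using (∼bag⇒↭)
open import Data.List.Relation.Binary.Permutation.Propositional.Properties
  using (↭-length)
open import Data.List.Relation.Unary.All as All using ([]; _∷_)
open import Data.List.Relation.Unary.All.Properties using (All¬⇒¬Any)
open import Data.List.Relation.Unary.AllPairs using ([]; _∷_)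
open import Data.List.Relation.Unary.Any using (here; there)
open import Data.List.Relation.Unary.Unique.Propositional using (Unique)
import Data.List.Relation.Unary.Unique.Propositional.Properties as Unique
open import Data.Nat as ℕ using (ℕ; zero; suc; _^_; _∸_; NonZero)
open import Data.Nat.Divisibility
open import Data.Nat.DivMod using (_%_; _mod_; m%n<n)
open import Data.Nat.Primality using (Prime; prime⇒nonZero; prime⇒nonTrivial; euclidsLemma)
open import Data.Nat.Properties as ℕ using (m^n≢0)
open import Data.Product using (_×_; _,_; proj₁; proj₂; ∃)
open import Data.Sum as Sum using (_⊎_; inj₁; inj₂; [_,_]′)
import Data.Vec as Vec
open import Data.Vec.Base using (here; there)
open import Data.Vec.Properties using (≡-dec; ∷-injectiveˡ; ∷-injectiveʳ)
open import Function using (_∘_; _⇔_; mk⇔)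
open import Level using (0ℓ)
open import Relation.Binary.PropositionalEquality
open import Relation.Nullary using (¬_; Dec; yes; no; contradiction)
open import Relation.Nullary.Decidable using (_×-dec_; _⊎-dec_; _→-dec_; ¬?)
open import Relation.Unary using (Pred; Decidable; _≐_)

open ≡-Reasoning

private
  variable
    T U : Set

-- Coefficients of polynomials

coeff-⊕ : ∀ f g k → coeff (f ⊕ g) k ≡ coeff f k ℤ.+ coeff g k
coeff-⊕ []      g       k       = sym (ℤ.+-identityˡ _)
coeff-⊕ (a ∷ f) []      k       = sym (ℤ.+-identityʳ _)
coeff-⊕ (a ∷ f) (b ∷ g) zero    = refl
coeff-⊕ (a ∷ f) (b ∷ g) (suc k) = coeff-⊕ f g k

-- Past the end of the list both sides read the default coefficient `0ℤ`, which is why `φ` has to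
-- fix it.
coeff-map : ∀ (φ : ℤ → ℤ) → φ 0ℤ ≡ 0ℤ → ∀ f k → coeff (map φ f) k ≡ φ (coeff f k)
coeff-map φ φ0≡0 []      k       = sym φ0≡0
coeff-map φ φ0≡0 (a ∷ f) zero    = refl
coeff-map φ φ0≡0 (a ∷ f) (suc k) = coeff-map φ φ0≡0 f k

coeff-⊗-zero : ∀ a f g → coeff ((a ∷ f) ⊗ g) 0 ≡ a ℤ.* coeff g 0
coeff-⊗-zero a f g = begin
  coeff ((a ∷ f) ⊗ g) 0              ≡⟨ coeff-⊕ (map (a ℤ.*_) g) _ 0 ⟩
  coeff (map (a ℤ.*_) g) 0 ℤ.+ 0ℤ    ≡⟨ ℤ.+-identityʳ _ ⟩
  coeff (map (a ℤ.*_) g) 0           ≡⟨ coeff-map (a ℤ.*_) (ℤ.*-zeroʳ a) g 0 ⟩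
  a ℤ.* coeff g 0                    ∎

-- The head `a` scales `g` in place, while `_⊗_` prepends `0ℤ` to the product with the tail, so that
-- product is read one degree lower.
coeff-⊗-suc : ∀ a f g k →
  coeff ((a ∷ f) ⊗ g) (suc k) ≡ a ℤ.* coeff g (suc k) ℤ.+ coeff (f ⊗ g) k
coeff-⊗-suc a f g k = begin
  coeff ((a ∷ f) ⊗ g) (suc k)
    ≡⟨ coeff-⊕ (map (a ℤ.*_) g) _ (suc k) ⟩
  coeff (map (a ℤ.*_) g) (suc k) ℤ.+ coeff (f ⊗ g) k
    ≡⟨ cong (ℤ._+ coeff (f ⊗ g) k) (coeff-map (a ℤ.*_) (ℤ.*-zeroʳ a) g (suc k)) ⟩
  a ℤ.* coeff g (suc k) ℤ.+ coeff (f ⊗ g) k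
    ∎

coeff-const-⊗ : ∀ a g k → coeff (const a ⊗ g) k ≡ a ℤ.* coeff g k
coeff-const-⊗ a g zero    = coeff-⊗-zero a [] g
coeff-const-⊗ a g (suc k) = trans (coeff-⊗-suc a [] g k) (ℤ.+-identityʳ _)

coeff-X⊗-suc : ∀ f k → coeff (X ⊗ f) (suc k) ≡ coeff f k
coeff-X⊗-suc f k = begin
  coeff (X ⊗ f) (suc k)                            ≡⟨ coeff-⊗-suc 0ℤ 𝟙 f k ⟩
  0ℤ ℤ.* coeff f (suc k) ℤ.+ coeff (𝟙 ⊗ f) k       ≡⟨ ℤ.+-identityˡ _ ⟩
  coeff (𝟙 ⊗ f) k                                  ≡⟨ coeff-const-⊗ 1ℤ f k ⟩
  1ℤ ℤ.* coeff f k                                 ≡⟨ ℤ.*-identityˡ _ ⟩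
  coeff f k                                        ∎

coeff-X↑-diag : ∀ k → coeff (X ↑ k) k ≡ 1ℤ
coeff-X↑-diag zero    = refl
coeff-X↑-diag (suc k) = trans (coeff-X⊗-suc (X ↑ k) k) (coeff-X↑-diag k)

coeff-X↑-off : ∀ j k → j ≢ k → coeff (X ↑ j) k ≡ 0ℤ
coeff-X↑-off zero    zero    j≢k = contradiction refl j≢k
coeff-X↑-off zero    (suc k) j≢k = refl
coeff-X↑-off (suc j) zero    j≢k = coeff-⊗-zero 0ℤ 𝟙 (X ↑ j)
coeff-X↑-off (suc j) (suc k) j≢k =
  trans (coeff-X⊗-suc (X ↑ j) k) (coeff-X↑-off j k (j≢k ∘ cong suc))

coeff-𝟙⊕X-zero : ∀ f → coeff ((𝟙 ⊕ X) ⊗ f) 0 ≡ coeff f 0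
coeff-𝟙⊕X-zero f = trans (coeff-⊗-zero 1ℤ (const 1ℤ) f) (ℤ.*-identityˡ _)

coeff-𝟙⊕X-suc : ∀ f k →
  coeff ((𝟙 ⊕ X) ⊗ f) (suc k) ≡ coeff f (suc k) ℤ.+ coeff f k
coeff-𝟙⊕X-suc f k = trans (coeff-⊗-suc 1ℤ (const 1ℤ) f k)
  (cong₂ ℤ._+_ (ℤ.*-identityˡ (coeff f (suc k)))
               (trans (coeff-const-⊗ 1ℤ f k) (ℤ.*-identityˡ (coeff f k))))

-- The body of `independencePolynomial` with arbitrary coefficients and exponents, so that induction
-- on the list of exponents is possible.
polynomial : (ℕ → ℤ) → List ℕ → Poly
polynomial c js = foldr _⊕_ 𝟘 (map (λ j → const (c j) ⊗ X ↑ j) js)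

coeff-polynomial-∷ : ∀ c j js k → coeff (polynomial c (j ∷ js)) k
  ≡ c j ℤ.* coeff (X ↑ j) k ℤ.+ coeff (polynomial c js) k
coeff-polynomial-∷ c j js k = trans (coeff-⊕ (const (c j) ⊗ X ↑ j) _ k)
  (cong (ℤ._+ coeff (polynomial c js) k) (coeff-const-⊗ (c j) (X ↑ j) k))

coeff-polynomial-∷-off : ∀ c {j} js {k} → j ≢ k →
  coeff (polynomial c (j ∷ js)) k ≡ coeff (polynomial c js) k
coeff-polynomial-∷-off c {j} js {k} j≢k = begin
  coeff (polynomial c (j ∷ js)) k
    ≡⟨ coeff-polynomial-∷ c j js k ⟩
  c j ℤ.* coeff (X ↑ j) k ℤ.+ coeff (polynomial c js) k
    ≡⟨ cong (λ z → c j ℤ.* z ℤ.+ coeff (polynomial c js) k) (coeff-X↑-off j k j≢k) ⟩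
  c j ℤ.* 0ℤ ℤ.+ coeff (polynomial c js) k
    ≡⟨ cong (ℤ._+ coeff (polynomial c js) k) (ℤ.*-zeroʳ (c j)) ⟩
  0ℤ ℤ.+ coeff (polynomial c js) k
    ≡⟨ ℤ.+-identityˡ _ ⟩
  coeff (polynomial c js) k
    ∎

coeff-polynomial-∉ : ∀ c js {k} → ¬ (k ∈ˡ js) → coeff (polynomial c js) k ≡ 0ℤ
coeff-polynomial-∉ c []       k∉js = refl
coeff-polynomial-∉ c (j ∷ js) k∉js =
  trans (coeff-polynomial-∷-off c js (λ j≡k → k∉js (here (sym j≡k))))
        (coeff-polynomial-∉ c js (k∉js ∘ there))

-- Since no exponent repeats, exactly one monomial contributes in degree `k`.
coeff-polynomial-∈ : ∀ c {js} {k} → Unique js → k ∈ˡ js → coeff (polynomial c js) k ≡ c k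
coeff-polynomial-∈ c {k ∷ js} (k∉js ∷ _) (here refl) = begin
  coeff (polynomial c (k ∷ js)) k
    ≡⟨ coeff-polynomial-∷ c k js k ⟩
  c k ℤ.* coeff (X ↑ k) k ℤ.+ coeff (polynomial c js) k
    ≡⟨ cong₂ (λ y z → c k ℤ.* y ℤ.+ z) (coeff-X↑-diag k)
         (coeff-polynomial-∉ c js (All¬⇒¬Any k∉js)) ⟩
  c k ℤ.* 1ℤ ℤ.+ 0ℤ
    ≡⟨ trans (ℤ.+-identityʳ _) (ℤ.*-identityʳ (c k)) ⟩
  c k
    ∎
coeff-polynomial-∈ c {j ∷ js} (j∉js ∷ js!) (there k∈js) =
  trans (coeff-polynomial-∷-off c js (All.lookup j∉js k∈js)) (coeff-polynomial-∈ c js! k∈js)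

-- Counting list elements

count : {P : Pred T 0ℓ} → Decidable P → List T → ℕ
count P? xs = length (filter P? xs)

count-++ : {P : Pred T 0ℓ} (P? : Decidable P) (xs ys : List T) →
  count P? (xs ++ ys) ≡ count P? xs ℕ.+ count P? ys
count-++ P? xs ys = trans (cong length (filter-++ P? xs ys)) (length-++ (filter P? xs))

count-map : {P : Pred U 0ℓ} (P? : Decidable P) (f : T → U) (xs : List T) →
  count P? (map f xs) ≡ count (P? ∘ f) xs
count-map P? f []       = refl
count-map P? f (x ∷ xs) with P? (f x)
... | yes _ = cong suc (count-map P? f xs)
... | no  _ = count-map P? f xs

count-≐ : {P Q : Pred T 0ℓ} (P? : Decidable P) (Q? : Decidable Q) → P ≐ Q →
  (xs : List T) → count P? xs ≡ count Q? xs
count-≐ P? Q? P≐Q xs = cong length (filter-≐ P? Q? P≐Q xs)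

count-none : {P : Pred T 0ℓ} (P? : Decidable P) → (∀ x → ¬ P x) → (xs : List T) → count P? xs ≡ 0
count-none P? ¬P xs = cong length (filter-none P? (All.universal ¬P xs))

count-filter : {P Q : Pred T 0ℓ} (P? : Decidable P) (Q? : Decidable Q) (xs : List T) →
  count P? (filter Q? xs) ≡ count (λ x → Q? x ×-dec P? x) xs
count-filter P? Q? []       = refl
count-filter P? Q? (x ∷ xs) with Q? x
... | no  _ = count-filter P? Q? xs
... | yes _ with P? x
...   | yes _ = cong suc (count-filter P? Q? xs)
...   | no  _ = count-filter P? Q? xs

count-⊎ : {P Q : Pred T 0ℓ} (P? : Decidable P) (Q? : Decidable Q) → (∀ {x} → P x → ¬ Q x) →
  (xs : List T) → count (λ x → P? x ⊎-dec Q? x) xs ≡ count P? xs ℕ.+ count Q? xs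
count-⊎ P? Q? disjoint []       = refl
count-⊎ P? Q? disjoint (x ∷ xs) with P? x | Q? x
... | yes p | yes q = contradiction q (disjoint p)
... | yes _ | no  _ = cong suc (count-⊎ P? Q? disjoint xs)
... | no  _ | yes _ = trans (cong suc (count-⊎ P? Q? disjoint xs)) (sym (ℕ.+-suc _ _))
... | no  _ | no  _ = count-⊎ P? Q? disjoint xs

-- Duplicate-free lists with the same members are permutations of each other. Counts by explicit
-- enumeration rest on this.
unique-length : {xs ys : List T} → Unique xs → Unique ys →
  (∀ {x} → x ∈ˡ xs ⇔ x ∈ˡ ys) → length xs ≡ length ys
unique-length xs! ys! xs∼ys = ↭-length (∼bag⇒↭ (unique∧set⇒bag xs! ys! xs∼ys))

-- Counting subsets

subsets-complete : ∀ {n} (S : Subset n) → S ∈ˡ subsets n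
subsets-complete Vec.[]              = here refl
subsets-complete (outside Vec.∷ S) = ∈-++⁺ˡ (∈-map⁺ (outside Vec.∷_) (subsets-complete S))
subsets-complete {suc n} (inside  Vec.∷ S) =
  ∈-++⁺ʳ (map (outside Vec.∷_) (subsets n)) (∈-map⁺ (inside Vec.∷_) (subsets-complete S))

subsets-unique : ∀ n → Unique (subsets n)
subsets-unique zero    = [] ∷ []
subsets-unique (suc n) = Unique.++⁺
  (Unique.map⁺ ∷-injectiveʳ (subsets-unique n))
  (Unique.map⁺ ∷-injectiveʳ (subsets-unique n))
  -- A member common to both halves would start with `outside` and with `inside`.
  λ (S∈out , S∈in) →
    let (_ , _ , S≡out) = ∈-map⁻ (outside Vec.∷_) S∈out
        (_ , _ , S≡in)  = ∈-map⁻ (inside Vec.∷_) S∈in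
    in contradiction (∷-injectiveˡ (trans (sym S≡out) S≡in)) λ ()

Supported : ∀ {n} → Pred (Fin n) 0ℓ → Pred (Subset n) 0ℓ
Supported Q S = ∀ a → a ∈ S → Q a

supported? : ∀ {n} {Q : Pred (Fin n) 0ℓ} → Decidable Q → Decidable (Supported Q)
supported? Q? S = all? λ a → (a ∈? S) →-dec Q? a

supported-outside : ∀ {n} {Q : Pred (Fin (suc n)) 0ℓ} {S} →
  Supported (Q ∘ suc) S → Supported Q (outside Vec.∷ S)
supported-outside sup (suc a) (there a∈S) = sup a a∈S

supported-inside : ∀ {n} {Q : Pred (Fin (suc n)) 0ℓ} {S} → Q zero →
  Supported (Q ∘ suc) S → Supported Q (inside Vec.∷ S)
supported-inside q sup zero    here        = q
supported-inside q sup (suc a) (there a∈S) = sup a a∈S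

supported-tail : ∀ {n} {Q : Pred (Fin (suc n)) 0ℓ} {s S} →
  Supported Q (s Vec.∷ S) → Supported (Q ∘ suc) S
supported-tail sup a a∈S = sup (suc a) (there a∈S)

-- The contribution of `zero` stays an unevaluated count, so that `pascal` can decide later whether
-- it is 0 or 1.
count-allFin-suc : ∀ {n} {P : Pred (Fin (suc n)) 0ℓ} (P? : Decidable P) →
  count P? (allFin (suc n)) ≡ count P? (zero ∷ []) ℕ.+ count (P? ∘ suc) (allFin n)
count-allFin-suc {n} P? = begin
  count P? (allFin (suc n))
    -- The tail of `allFin (suc n)` is a tabulation of `suc`, not literally a `map`.
    ≡⟨ cong (λ xs → count P? (zero ∷ xs)) (map-tabulate (λ i → i) suc) ⟨
  count P? (zero ∷ map suc (allFin n))
    ≡⟨ count-++ P? (zero ∷ []) (map suc (allFin n)) ⟩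
  count P? (zero ∷ []) ℕ.+ count P? (map suc (allFin n))
    ≡⟨ cong (count P? (zero ∷ []) ℕ.+_) (count-map P? suc (allFin n)) ⟩
  count P? (zero ∷ []) ℕ.+ count (P? ∘ suc) (allFin n)
    ∎

supportedOfSize? : ∀ {n} {Q : Pred (Fin n) 0ℓ} → Decidable Q → ∀ k →
  Decidable (λ S → Supported Q S × ∣ S ∣ ≡ k)
supportedOfSize? Q? k S = supported? Q? S ×-dec (∣ S ∣ ℕ.≟ k)

-- Binomial theorem by induction on the ground set: a label in `Q` may be left out or taken, giving
-- a factor `𝟙 ⊕ X`, and any other label must be left out, giving a factor 1.
count-supported : ∀ n {Q : Pred (Fin n) 0ℓ} (Q? : Decidable Q) k →
  + count (supportedOfSize? Q? k) (subsets n) ≡ coeff ((𝟙 ⊕ X) ↑ count Q? (allFin n)) k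
count-supported zero    Q? zero    = refl
count-supported zero    Q? (suc k) = refl
count-supported (suc n) {Q} Q? k = begin
  + count (supportedOfSize? Q? k) (subsets (suc n))
    ≡⟨ cong +_ (count-++ (supportedOfSize? Q? k) (map (outside Vec.∷_) (subsets n)) _) ⟩
  + (count (supportedOfSize? Q? k) (map (outside Vec.∷_) (subsets n)) ℕ.+
     count (supportedOfSize? Q? k) (map (inside Vec.∷_) (subsets n)))
    ≡⟨ cong₂ (λ x y → + (x ℕ.+ y)) count-outside
         (count-map (supportedOfSize? Q? k) (inside Vec.∷_) (subsets n)) ⟩
  + (count (supportedOfSize? (Q? ∘ suc) k) (subsets n) ℕ.+ count inside? (subsets n))
    ≡⟨ ℤ.pos-+ (count (supportedOfSize? (Q? ∘ suc) k) (subsets n)) _ ⟩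
  + count (supportedOfSize? (Q? ∘ suc) k) (subsets n) ℤ.+ + count inside? (subsets n)
    ≡⟨ cong (ℤ._+ + count inside? (subsets n)) (count-supported n (Q? ∘ suc) k) ⟩
  coeff ((𝟙 ⊕ X) ↑ count (Q? ∘ suc) (allFin n)) k ℤ.+ + count inside? (subsets n)
    ≡⟨ pascal k (Q? zero) ⟩
  coeff ((𝟙 ⊕ X) ↑ (count Q? (zero ∷ []) ℕ.+ count (Q? ∘ suc) (allFin n))) k
    ≡⟨ cong (λ m → coeff ((𝟙 ⊕ X) ↑ m) k) (count-allFin-suc Q?) ⟨
  coeff ((𝟙 ⊕ X) ↑ count Q? (allFin (suc n))) k
    ∎
  where
  -- The size is bound afresh because `pascal` splits on it.
  inside? : ∀ {k} → Decidable (λ S → Supported Q (inside Vec.∷ S) × suc ∣ S ∣ ≡ k)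
  inside? {k} S = supportedOfSize? Q? k (inside Vec.∷ S)

  count-outside : count (supportedOfSize? Q? k) (map (outside Vec.∷_) (subsets n))
                ≡ count (supportedOfSize? (Q? ∘ suc) k) (subsets n)
  count-outside = trans
    (count-map (supportedOfSize? Q? k) (outside Vec.∷_) (subsets n))
    (count-≐ _ (supportedOfSize? (Q? ∘ suc) k)
      ( (λ (sup , size) → supported-tail sup , size)
      , (λ (sup , size) → supported-outside sup , size))
      (subsets n))

  m = count (Q? ∘ suc) (allFin n)

  -- If `zero` is not in `Q`, no supported set contains it and the exponent stays `m`. Otherwise the
  -- exponent is `suc m`, and the claim is the recursion for multiplying by `𝟙 ⊕ X`. In degree 0
  -- there is nothing to add, as a set containing `zero` is nonempty.
  pascal : ∀ k → Dec (Q zero) →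
    coeff ((𝟙 ⊕ X) ↑ m) k ℤ.+ + count (inside? {k}) (subsets n)
    ≡ coeff ((𝟙 ⊕ X) ↑ (count Q? (zero ∷ []) ℕ.+ m)) k
  pascal k (no ¬q) = begin
    coeff ((𝟙 ⊕ X) ↑ m) k ℤ.+ + count (inside? {k}) (subsets n)
      ≡⟨ cong (λ c → coeff ((𝟙 ⊕ X) ↑ m) k ℤ.+ + c)
           (count-none (inside? {k}) (λ S (sup , _) → ¬q (sup zero here)) (subsets n)) ⟩
    coeff ((𝟙 ⊕ X) ↑ m) k ℤ.+ 0ℤ
      ≡⟨ ℤ.+-identityʳ _ ⟩
    coeff ((𝟙 ⊕ X) ↑ m) k
      ≡⟨ cong (λ xs → coeff ((𝟙 ⊕ X) ↑ (length xs ℕ.+ m)) k) (filter-reject Q? ¬q) ⟨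
    coeff ((𝟙 ⊕ X) ↑ (count Q? (zero ∷ []) ℕ.+ m)) k
      ∎
  pascal zero (yes q) = begin
    coeff ((𝟙 ⊕ X) ↑ m) 0 ℤ.+ + count (inside? {0}) (subsets n)
      ≡⟨ cong (λ c → coeff ((𝟙 ⊕ X) ↑ m) 0 ℤ.+ + c)
           (count-none (inside? {0}) (λ { S (_ , ()) }) (subsets n)) ⟩
    coeff ((𝟙 ⊕ X) ↑ m) 0 ℤ.+ 0ℤ
      ≡⟨ ℤ.+-identityʳ _ ⟩
    coeff ((𝟙 ⊕ X) ↑ m) 0
      ≡⟨ coeff-𝟙⊕X-zero ((𝟙 ⊕ X) ↑ m) ⟨
    coeff ((𝟙 ⊕ X) ↑ suc m) 0
      ≡⟨ cong (λ xs → coeff ((𝟙 ⊕ X) ↑ (length xs ℕ.+ m)) 0) (filter-accept Q? q) ⟨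
    coeff ((𝟙 ⊕ X) ↑ (count Q? (zero ∷ []) ℕ.+ m)) 0
      ∎
  pascal (suc k) (yes q) = begin
    coeff ((𝟙 ⊕ X) ↑ m) (suc k) ℤ.+ + count (inside? {suc k}) (subsets n)
      ≡⟨ cong (λ c → coeff ((𝟙 ⊕ X) ↑ m) (suc k) ℤ.+ + c)
           (count-≐ (inside? {suc k}) (supportedOfSize? (Q? ∘ suc) k)
             ( (λ (sup , size) → supported-tail sup , ℕ.suc-injective size)
             , (λ (sup , size) → supported-inside q sup , cong suc size))
             (subsets n)) ⟩
    coeff ((𝟙 ⊕ X) ↑ m) (suc k) ℤ.+ + count (supportedOfSize? (Q? ∘ suc) k) (subsets n)
      -- Removing `zero` has lowered the size by one, so the induction hypothesis applies a second
      -- time, now at size `k`.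
      ≡⟨ cong (λ c → coeff ((𝟙 ⊕ X) ↑ m) (suc k) ℤ.+ c) (count-supported n (Q? ∘ suc) k) ⟩
    coeff ((𝟙 ⊕ X) ↑ m) (suc k) ℤ.+ coeff ((𝟙 ⊕ X) ↑ m) k
      ≡⟨ coeff-𝟙⊕X-suc ((𝟙 ⊕ X) ↑ m) k ⟨
    coeff ((𝟙 ⊕ X) ↑ suc m) (suc k)
      ≡⟨ cong (λ xs → coeff ((𝟙 ⊕ X) ↑ (length xs ℕ.+ m)) (suc k)) (filter-accept Q? q) ⟨
    coeff ((𝟙 ⊕ X) ↑ (count Q? (zero ∷ []) ℕ.+ m)) (suc k)
      ∎

-- Counting singletons

SingletonOf : ∀ {n} → Pred (Fin n) 0ℓ → Pred (Subset n) 0ℓ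
SingletonOf P S = ∃ λ a → P a × S ≡ ⁅ a ⁆

singletonOf? : ∀ {n} {P : Pred (Fin n) 0ℓ} → Decidable P → Decidable (SingletonOf P)
singletonOf? P? S = any? λ a → P? a ×-dec ≡-dec _≟ᵇ_ S ⁅ a ⁆

⁅⁆-injective : ∀ {n} {a b : Fin n} → ⁅ a ⁆ ≡ ⁅ b ⁆ → a ≡ b
⁅⁆-injective {a = a} {b} eq = x∈⁅y⁆⇒x≡y b (subst (a ∈_) eq (x∈⁅x⁆ a))

-- The injection `⁅_⁆` carries the elements satisfying `P` onto the singletons being counted.
count-singletonOf : ∀ {n} {P : Pred (Fin n) 0ℓ} (P? : Decidable P) →
  count (singletonOf? P?) (subsets n) ≡ count P? (allFin n)
count-singletonOf {n} P? = trans
  (unique-length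
    (Unique.filter⁺ (singletonOf? P?) (subsets-unique n))
    (Unique.map⁺ ⁅⁆-injective (Unique.filter⁺ P? (Unique.allFin⁺ n)))
    (mk⇔
      (λ S∈ → let (_ , a , Pa , S≡⁅a⁆) = ∈-filter⁻ (singletonOf? P?) {xs = subsets n} S∈
               in subst (_∈ˡ _) (sym S≡⁅a⁆) (∈-map⁺ ⁅_⁆ (∈-filter⁺ P? (∈-allFin a) Pa)))
      (λ S∈ → let (a , a∈ , S≡⁅a⁆) = ∈-map⁻ ⁅_⁆ S∈
               in ∈-filter⁺ (singletonOf? P?) (subsets-complete _)
                    (a , proj₂ (∈-filter⁻ P? {xs = allFin n} a∈) , S≡⁅a⁆))))
  (length-map ⁅_⁆ (filter P? (allFin n)))

singletonOfSize? : ∀ {n} {P : Pred (Fin n) 0ℓ} → Decidable P → ∀ k →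
  Decidable (λ S → SingletonOf P S × ∣ S ∣ ≡ k)
singletonOfSize? P? k S = singletonOf? P? S ×-dec (∣ S ∣ ℕ.≟ k)

-- Singletons have size 1, so the counts vanish in every degree but the first, as do the
-- coefficients of a multiple of `X`.
count-singletonOfSize : ∀ {n} {P : Pred (Fin n) 0ℓ} (P? : Decidable P) k →
  + count (singletonOfSize? P? k) (subsets n) ≡ coeff (const (+ count P? (allFin n)) ⊗ X) k
count-singletonOfSize {n} P? k =
  trans (lemma k) (sym (coeff-const-⊗ (+ count P? (allFin n)) X k))
  where
  size : ∀ {S} → SingletonOf _ S → ∣ S ∣ ≡ 1
  size (a , _ , refl) = ∣⁅x⁆∣≡1 a

  none : ∀ {k} → k ≢ 1 → + count (singletonOfSize? P? k) (subsets n) ≡ 0ℤ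
  none {k} k≢1 = cong +_ (count-none (singletonOfSize? P? k)
    (λ S (single , ∣S∣≡k) → k≢1 (trans (sym ∣S∣≡k) (size single))) (subsets n))

  lemma : ∀ k → + count (singletonOfSize? P? k) (subsets n)
              ≡ + count P? (allFin n) ℤ.* coeff X k
  lemma 0 = trans (none λ ()) (sym (ℤ.*-zeroʳ (+ count P? (allFin n))))
  lemma 1 = begin
    + count (singletonOfSize? P? 1) (subsets n)
      ≡⟨ cong +_ (count-≐ (singletonOfSize? P? 1) (singletonOf? P?)
           (proj₁ , λ single → single , size single) (subsets n)) ⟩
    + count (singletonOf? P?) (subsets n)
      ≡⟨ cong +_ (count-singletonOf P?) ⟩
    + count P? (allFin n)
      ≡⟨ ℤ.*-identityʳ _ ⟨
    + count P? (allFin n) ℤ.* 1ℤ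
      ∎
  lemma (suc (suc k)) = trans (none λ ()) (sym (ℤ.*-zeroʳ (+ count P? (allFin n))))

-- Independence polynomials

module _ {n} (G : FiniteGraph n) where

  ∣S∣≤α : ∀ {S} → Independent G S → ∣ S ∣ ℕ.≤ α G
  ∣S∣≤α {S} ind = All.lookup (xs≤max 0 (map ∣_∣ (independentSets G)))
    (∈-map⁺ ∣_∣ (∈-filter⁺ (independent? G) (subsets-complete S) ind))

  -- Cutting the sum off at `α G` loses nothing: no independent set is larger, so `s G k` is 0
  -- beyond that point.
  coeff-independencePolynomial : ∀ k → coeff (independencePolynomial G) k ≡ + s G k
  coeff-independencePolynomial k with k ℕ.≤? α G
  -- The bound of `upTo` is exclusive, hence the shift by one.
  ... | yes k≤α = coeff-polynomial-∈ (λ j → + s G j) (Unique.upTo⁺ (suc (α G)))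
                    (∈-upTo⁺ (ℕ.s≤s k≤α))
  ... | no  k≰α = trans
    (coeff-polynomial-∉ (λ j → + s G j) (upTo (suc (α G)))
      (λ k∈ → k≰α (ℕ.s≤s⁻¹ (∈-upTo⁻ k∈))))
    (cong +_ (sym (trans
      (count-filter (λ S → ∣ S ∣ ℕ.≟ k) (independent? G) (subsets n))
      (count-none _ (λ { S (ind , refl) → k≰α (∣S∣≤α ind) }) (subsets n)))))

-- Complete split graphs

record CompleteSplit {n} (G : FiniteGraph n) (Q K : Pred (Fin n) 0ℓ) : Set where
  open FiniteGraph G
  field
    vertex⇒Q⊎K    : ∀ {a} → Vertex a → Q a ⊎ K a
    Q⇒vertex      : ∀ {a} → Q a → Vertex a
    K⇒vertex      : ∀ {a} → K a → Vertex a
    disjoint      : ∀ {a} → Q a → ¬ K a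
    Q-independent : ∀ {a b} → Q a → Q b → ¬ (a ~ b)
    -- Because `b` ranges over all vertices, this makes `K` a clique and also joins it to all of
    -- `Q`.
    K-dominating  : ∀ {a b} → K a → Vertex b → a ≢ b → a ~ b

module _ {n} {G : FiniteGraph n} {Q K : Pred (Fin n) 0ℓ}
         (Q? : Decidable Q) (K? : Decidable K) (split : CompleteSplit G Q K) where
  open FiniteGraph G
  open CompleteSplit split

  -- An independent set containing some `a` in `K` contains nothing else, since `a` is adjacent to
  -- every other vertex. One that avoids `K` lies in `Q`.
  independent⇒ : ∀ {S} → Independent G S → Supported Q S ⊎ SingletonOf K S
  independent⇒ {S} (S⊆V , indep) with any? (λ a → (a ∈? S) ×-dec K? a)
  ... | yes (a , a∈S , Ka) = inj₂ (a , Ka , ⊆-antisym S⊆⁅a⁆ ⁅a⁆⊆S)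
    where
    S⊆⁅a⁆ : ∀ {b} → b ∈ S → b ∈ ⁅ a ⁆
    S⊆⁅a⁆ {b} b∈S with a ≟ᶠ b
    ... | yes refl = x∈⁅x⁆ a
    ... | no  a≢b  =
      contradiction (K-dominating Ka (S⊆V b b∈S) a≢b) (indep a b a∈S b∈S)

    ⁅a⁆⊆S : ∀ {b} → b ∈ ⁅ a ⁆ → b ∈ S
    ⁅a⁆⊆S b∈⁅a⁆ = subst (_∈ S) (sym (x∈⁅y⁆⇒x≡y a b∈⁅a⁆)) a∈S
  ... | no ∄a = inj₁ λ a a∈S →
    [ (λ Qa → Qa) , (λ Ka → contradiction (a , a∈S , Ka) ∄a) ]′ (vertex⇒Q⊎K (S⊆V a a∈S))

  independent⇐ : ∀ {S} → Supported Q S ⊎ SingletonOf K S → Independent G S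
  independent⇐ (inj₁ S⊆Q) =
      (λ a a∈S → Q⇒vertex (S⊆Q a a∈S))
    , (λ a b a∈S b∈S → Q-independent (S⊆Q a a∈S) (S⊆Q b b∈S))
  independent⇐ (inj₂ (c , Kc , refl)) =
      (λ a a∈S → subst Vertex (sym (x∈⁅y⁆⇒x≡y c a∈S)) (K⇒vertex Kc))
    -- Two members of a singleton coincide, and no vertex is adjacent to itself.
    , (λ a b a∈S b∈S →
         ~-irrefl (trans (x∈⁅y⁆⇒x≡y c a∈S) (sym (x∈⁅y⁆⇒x≡y c b∈S))))

  -- The two kinds of independent sets are disjoint, so their counts add in each size. The empty set
  -- is counted with the subsets of `Q`, so `K` contributes only a linear term.
  completeSplit-independencePolynomial :
    independencePolynomial G
    ≈ (𝟙 ⊕ X) ↑ count Q? (allFin n) ⊕ const (+ count K? (allFin n)) ⊗ X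
  completeSplit-independencePolynomial k = begin
    coeff (independencePolynomial G) k
      ≡⟨ coeff-independencePolynomial G k ⟩
    + s G k
      ≡⟨ cong +_ (count-filter (λ S → ∣ S ∣ ℕ.≟ k) (independent? G) (subsets n)) ⟩
    + count (λ S → independent? G S ×-dec (∣ S ∣ ℕ.≟ k)) (subsets n)
      ≡⟨ cong +_ (count-≐ _ (λ S → supportedOfSize? Q? k S ⊎-dec singletonOfSize? K? k S)
           ( (λ (ind , size) → Sum.map (_, size) (_, size) (independent⇒ ind))
           , [ (λ (sup , size) → independent⇐ (inj₁ sup) , size)
             , (λ (single , size) → independent⇐ (inj₂ single) , size) ]′)
           (subsets n)) ⟩
    + count (λ S → supportedOfSize? Q? k S ⊎-dec singletonOfSize? K? k S) (subsets n)
      ≡⟨ cong +_ (count-⊎ (supportedOfSize? Q? k) (singletonOfSize? K? k)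
           -- A singleton of both kinds would have its element in both `Q` and `K`.
           (λ { (sup , _) ((a , Ka , refl) , _) → disjoint (sup a (x∈⁅x⁆ a)) Ka })
           (subsets n)) ⟩
    + (count (supportedOfSize? Q? k) (subsets n) ℕ.+
       count (singletonOfSize? K? k) (subsets n))
      ≡⟨ ℤ.pos-+ (count (supportedOfSize? Q? k) (subsets n)) _ ⟩
    + count (supportedOfSize? Q? k) (subsets n) ℤ.+
    + count (singletonOfSize? K? k) (subsets n)
      ≡⟨ cong₂ ℤ._+_ (count-supported n Q? k) (count-singletonOfSize K? k) ⟩
    coeff ((𝟙 ⊕ X) ↑ count Q? (allFin n)) k ℤ.+ coeff (const (+ count K? (allFin n)) ⊗ X) k
      ≡⟨ coeff-⊕ ((𝟙 ⊕ X) ↑ count Q? (allFin n)) _ k ⟨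
    coeff ((𝟙 ⊕ X) ↑ count Q? (allFin n) ⊕ const (+ count K? (allFin n)) ⊗ X) k
      ∎

-- Zero divisors of ℤ_{p³}

module _ (n : ℕ) .{{_ : NonZero n}} where

  toℕ-mod : ∀ m → toℕ (m mod n) ≡ m % n
  toℕ-mod m = toℕ-fromℕ< (m%n<n m n)

  toℕ-0ₙ : toℕ (0ₙ n) ≡ 0
  toℕ-0ₙ = trans (toℕ-mod 0) (n∣m⇒m%n≡0 0 n (n ∣0))

  ≢0ₙ⇒toℕ≢0 : ∀ {a} → a ≢ 0ₙ n → toℕ a ≢ 0
  ≢0ₙ⇒toℕ≢0 a≢0 a≡0 = a≢0 (toℕ-injective (trans a≡0 (sym toℕ-0ₙ)))

  toℕ≢0⇒≢0ₙ : ∀ {a} → toℕ a ≢ 0 → a ≢ 0ₙ n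
  toℕ≢0⇒≢0ₙ a≢0 a≡0 = a≢0 (trans (cong toℕ a≡0) toℕ-0ₙ)

  mod≡0ₙ⇒∣ : ∀ {m} → m mod n ≡ 0ₙ n → n ∣ m
  mod≡0ₙ⇒∣ {m} eq = m%n≡0⇒n∣m m n (trans (sym (toℕ-mod m)) (trans (cong toℕ eq) toℕ-0ₙ))

  ∣⇒mod≡0ₙ : ∀ {m} → n ∣ m → m mod n ≡ 0ₙ n
  ∣⇒mod≡0ₙ {m} n∣m =
    toℕ-injective (trans (toℕ-mod m) (trans (n∣m⇒m%n≡0 m n n∣m) (sym toℕ-0ₙ)))

-- Counting nonzero multiples

NonzeroMultiple : ∀ {n} → ℕ → Pred (Fin n) 0ℓ
NonzeroMultiple d a = toℕ a ≢ 0 × d ∣ toℕ a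

nonzeroMultiple? : ∀ {n} d → Decidable (NonzeroMultiple {n} d)
nonzeroMultiple? d a = ¬? (toℕ a ℕ.≟ 0) ×-dec (d ∣? toℕ a)

-- Below (m+1)d the nonzero multiples of d are d, 2d, ..., md.
count-nonzeroMultiple : ∀ {n} d m .{{_ : NonZero d}} → n ≡ suc m ℕ.* d →
  count (nonzeroMultiple? d) (allFin n) ≡ m
count-nonzeroMultiple {n} d@(suc _) m refl = begin
  count (nonzeroMultiple? d) (allFin n)
    ≡⟨ length-map toℕ (filter (nonzeroMultiple? d) (allFin n)) ⟨
  length (map toℕ (filter (nonzeroMultiple? d) (allFin n)))
    ≡⟨ unique-length
         (Unique.map⁺ toℕ-injective
           (Unique.filter⁺ (nonzeroMultiple? d) (Unique.allFin⁺ n)))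
         (Unique.applyUpTo⁺₁ multiple m λ i<j _ eq →
           ℕ.<⇒≢ i<j (ℕ.suc-injective (ℕ.*-cancelʳ-≡ _ _ d eq)))
         (mk⇔ to from) ⟩
  length (applyUpTo multiple m)
    ≡⟨ length-applyUpTo multiple m ⟩
  m
    ∎
  where
  multiple : ℕ → ℕ
  multiple i = suc i ℕ.* d

  multiple∈ : ∀ {x} → x ≢ 0 → x ℕ.< n → d ∣ x → x ∈ˡ applyUpTo multiple m
  multiple∈ x≢0 x<n (divides zero    refl) = contradiction refl x≢0
  multiple∈ x≢0 x<n (divides (suc i) refl) =
    ∈-applyUpTo⁺ multiple (ℕ.s<s⁻¹ (ℕ.*-cancelʳ-< d (suc i) (suc m) x<n))

  to : ∀ {x} → x ∈ˡ map toℕ (filter (nonzeroMultiple? d) (allFin n)) →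
       x ∈ˡ applyUpTo multiple m
  to x∈ with ∈-map⁻ toℕ x∈
  ... | a , a∈ , refl with ∈-filter⁻ (nonzeroMultiple? d) {xs = allFin n} a∈
  ...   | _ , a≢0 , d∣a = multiple∈ a≢0 (toℕ<n a) d∣a

  from : ∀ {x} → x ∈ˡ applyUpTo multiple m →
         x ∈ˡ map toℕ (filter (nonzeroMultiple? d) (allFin n))
  from x∈ with ∈-applyUpTo⁻ multiple x∈
  ... | i , i<m , refl = subst (_∈ˡ map toℕ (filter (nonzeroMultiple? d) (allFin n))) a≡x
    (∈-map⁺ toℕ (∈-filter⁺ (nonzeroMultiple? d) (∈-allFin a)
      -- As `d` is matched as a successor, `multiple i` reduces to a successor and cannot equal 0.
      ( (λ a≡0 → contradiction (trans (sym a≡x) a≡0) λ ())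
      , subst (d ∣_) (sym a≡x) (n∣m*n (suc i)))))
    where
    x<n : multiple i ℕ.< n
    x<n = ℕ.*-monoˡ-< d (ℕ.s<s i<m)
    a : Fin n
    a = fromℕ< x<n
    a≡x : toℕ a ≡ multiple i
    a≡x = toℕ-fromℕ< x<n

-- Euclid's lemma gives b = cp; cancelling one factor p from both sides leaves the same situation
-- for a, c and the next lower power.
prime^-∣-cancelˡ : ∀ {p} → Prime p → ∀ k a b → ¬ (p ∣ a) → p ^ k ∣ a ℕ.* b → p ^ k ∣ b
prime^-∣-cancelˡ         pp zero    a b p∤a _       = 1∣ b
prime^-∣-cancelˡ {p} pp (suc k) a b p∤a p^1+k∣ab
  with euclidsLemma a b pp (m*n∣⇒m∣ p (p ^ k) p^1+k∣ab)
... | inj₁ p∣a              = contradiction p∣a p∤a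
... | inj₂ (divides c refl) = subst (p ^ suc k ∣_) (ℕ.*-comm p c)
  (*-monoʳ-∣ p (prime^-∣-cancelˡ pp k a c p∤a
    (*-cancelˡ-∣ p {{prime⇒nonZero pp}} (subst (p ^ suc k ∣_) a*[c*p]≡p*[a*c] p^1+k∣ab))))
  where
  a*[c*p]≡p*[a*c] : a ℕ.* (c ℕ.* p) ≡ p ℕ.* (a ℕ.* c)
  a*[c*p]≡p*[a*c] = trans (sym (ℕ.*-assoc a c p)) (ℕ.*-comm (a ℕ.* c) p)

-- The complete split structure of Γ(ℤ_{p³})

module _ {p : ℕ} (p-prime : Prime p) where

  private
    instance
      p-nonZero : NonZero p
      p-nonZero = prime⇒nonZero p-prime
      p²-nonZero : NonZero (p ^ 2)
      p²-nonZero = m^n≢0 p 2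
      p³-nonZero : NonZero (p ^ 3)
      p³-nonZero = m^n≢0 p 3

    n = p ^ 3

    p*p≡p² : p ℕ.* p ≡ p ^ 2
    p*p≡p² = cong (p ℕ.*_) (sym (ℕ.*-identityʳ p))

    p²<p³ : p ^ 2 ℕ.< p ^ 3
    p²<p³ = ℕ.^-monoʳ-< p (ℕ.nonTrivial⇒n>1 p {{prime⇒nonTrivial p-prime}}) (ℕ.n<1+n 2)

  -- These are the residues of p-adic valuation exactly 1; zero is excluded because p² divides it.
  ExactMultiple : Pred (Fin n) 0ℓ
  ExactMultiple a = p ∣ toℕ a × ¬ (p ^ 2 ∣ toℕ a)

  exactMultiple? : Decidable ExactMultiple
  exactMultiple? a = (p ∣? toℕ a) ×-dec ¬? (p ^ 2 ∣? toℕ a)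

  exactMultiple⇒nonzeroMultiple : ∀ {a} → ExactMultiple a → NonzeroMultiple p a
  exactMultiple⇒nonzeroMultiple (p∣a , p²∤a) =
    (λ a≡0 → p²∤a (subst (p ^ 2 ∣_) (sym a≡0) ((p ^ 2) ∣0))) , p∣a

  p²-multiple⇒p-multiple : ∀ {a : Fin n} → NonzeroMultiple (p ^ 2) a → NonzeroMultiple p a
  p²-multiple⇒p-multiple (a≢0 , p²∣a) = a≢0 , m*n∣⇒m∣ p (p ^ 1) p²∣a

  -- The annihilator is p² itself, a nonzero residue because 0 < p² < p³.
  p-multiple⇒vertex : ∀ {a} → NonzeroMultiple p a → NonZeroZeroDivisor n a
  p-multiple⇒vertex {a} (a≢0 , p∣a) =
      toℕ≢0⇒≢0ₙ n a≢0
    , b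
    , toℕ≢0⇒≢0ₙ n (λ b≡0 → ℕ.≢-nonZero⁻¹ (p ^ 2) (trans (sym b≡p²) b≡0))
    , ∣⇒mod≡0ₙ n (subst (λ b → p ^ 3 ∣ toℕ a ℕ.* b) (sym b≡p²) (*-monoˡ-∣ (p ^ 2) p∣a))
    where
    b : Fin n
    b = fromℕ< p²<p³
    b≡p² : toℕ b ≡ p ^ 2
    b≡p² = toℕ-fromℕ< p²<p³

  -- If p did not divide a, then p³ dividing ab would force p³ to divide b, which is impossible for
  -- 0 < b < p³.
  vertex⇒p-multiple : ∀ {a} → NonZeroZeroDivisor n a → NonzeroMultiple p a
  vertex⇒p-multiple {a} (a≢0 , b , b≢0 , ab≡0) with p ∣? toℕ a
  ... | yes p∣a = ≢0ₙ⇒toℕ≢0 n a≢0 , p∣a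
  ... | no  p∤a = contradiction (toℕ<n b) (ℕ.≤⇒≯ p³≤b)
    where
    p³≤b : p ^ 3 ℕ.≤ toℕ b
    p³≤b = ∣⇒≤ {{ℕ.≢-nonZero (≢0ₙ⇒toℕ≢0 n b≢0)}}
      (prime^-∣-cancelˡ p-prime 3 (toℕ a) (toℕ b) p∤a (mod≡0ₙ⇒∣ n ab≡0))

  -- Write a = cp, where p does not divide c because p² does not divide a. If p³ divided ab, then p²
  -- would divide cb and hence b.
  p³∤exact*exact : ∀ {a b} → ¬ (p ^ 2 ∣ a) → p ∣ a → ¬ (p ^ 2 ∣ b) → ¬ (p ^ 3 ∣ a ℕ.* b)
  p³∤exact*exact {b = b} p²∤a (divides c refl) p²∤b p³∣ab =
    p²∤b (prime^-∣-cancelˡ p-prime 2 c b p∤c (*-cancelˡ-∣ p p³∣p*[c*b]))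
    where
    p∤c : ¬ (p ∣ c)
    p∤c p∣c = p²∤a (subst (_∣ c ℕ.* p) p*p≡p² (*-monoˡ-∣ p p∣c))

    p³∣p*[c*b] : p ℕ.* p ^ 2 ∣ p ℕ.* (c ℕ.* b)
    p³∣p*[c*b] = subst (p ^ 3 ∣_)
      (trans (cong (ℕ._* b) (ℕ.*-comm c p)) (ℕ.*-assoc p c b)) p³∣ab

  Γ[p³]-completeSplit : CompleteSplit (Γ n) ExactMultiple (NonzeroMultiple (p ^ 2))
  Γ[p³]-completeSplit = record
    { vertex⇒Q⊎K    = split ∘ vertex⇒p-multiple
    ; Q⇒vertex      = p-multiple⇒vertex ∘ exactMultiple⇒nonzeroMultiple
    ; K⇒vertex      = p-multiple⇒vertex ∘ p²-multiple⇒p-multiple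
    ; disjoint      = λ (_ , p²∤a) (_ , p²∣a) → p²∤a p²∣a
    ; Q-independent = λ (p∣a , p²∤a) (_ , p²∤b) (_ , _ , ab≡0) →
        p³∤exact*exact p²∤a p∣a p²∤b (mod≡0ₙ⇒∣ n ab≡0)
    ; K-dominating  = λ {a} {b} Ka@(_ , p²∣a) Vb a≢b →
        (p-multiple⇒vertex (p²-multiple⇒p-multiple Ka) , Vb) , a≢b ,
        -- From p² dividing a and p dividing b, the product ab is a multiple of p²·p.
        ∣⇒mod≡0ₙ n (subst (_∣ toℕ a ℕ.* toℕ b) (ℕ.*-comm (p ^ 2) p)
          (*-pres-∣ p²∣a (proj₂ (vertex⇒p-multiple Vb))))
    }
    where
    split : ∀ {a} → NonzeroMultiple p a → ExactMultiple a ⊎ NonzeroMultiple (p ^ 2) a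
    split {a} (a≢0 , p∣a) with p ^ 2 ∣? toℕ a
    ... | yes p²∣a = inj₂ (a≢0 , p²∣a)
    ... | no  p²∤a = inj₁ (p∣a , p²∤a)

  -- The sizes of the two parts

  count-p²-multiple : count (nonzeroMultiple? (p ^ 2)) (allFin n) ≡ ℕ.pred p
  count-p²-multiple = count-nonzeroMultiple (p ^ 2) (ℕ.pred p)
    (cong (ℕ._* p ^ 2) (sym (ℕ.suc-pred p)))

  count-p-multiple : count (nonzeroMultiple? p) (allFin n) ≡ ℕ.pred (p ^ 2)
  count-p-multiple = count-nonzeroMultiple p (ℕ.pred (p ^ 2))
    (trans (ℕ.*-comm p (p ^ 2)) (cong (ℕ._* p) (sym (ℕ.suc-pred (p ^ 2)))))

  -- Counted by complement among the nonzero multiples of p: (p² - 1) - (p - 1).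
  count-exactMultiple : count exactMultiple? (allFin n) ≡ p ^ 2 ∸ p
  count-exactMultiple = begin
    count exactMultiple? (allFin n)
      ≡⟨ ℕ.m+n∸n≡m _ (count (nonzeroMultiple? (p ^ 2)) (allFin n)) ⟨
    count exactMultiple? (allFin n) ℕ.+ count (nonzeroMultiple? (p ^ 2)) (allFin n)
      ∸ count (nonzeroMultiple? (p ^ 2)) (allFin n)
      ≡⟨ cong₂ _∸_ all-multiples count-p²-multiple ⟩
    ℕ.pred (p ^ 2) ∸ ℕ.pred p
      -- Truncated subtraction strips a successor from both arguments by computation, so both
      -- predecessors can be undone at once.
      ≡⟨ cong₂ _∸_ (ℕ.suc-pred (p ^ 2)) (ℕ.suc-pred p) ⟩
    p ^ 2 ∸ p
      ∎
    where
    open CompleteSplit Γ[p³]-completeSplit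

    all-multiples : count exactMultiple? (allFin n) ℕ.+
      count (nonzeroMultiple? (p ^ 2)) (allFin n) ≡ ℕ.pred (p ^ 2)
    all-multiples = begin
      count exactMultiple? (allFin n) ℕ.+ count (nonzeroMultiple? (p ^ 2)) (allFin n)
        ≡⟨ count-⊎ exactMultiple? (nonzeroMultiple? (p ^ 2)) disjoint (allFin n) ⟨
      count (λ a → exactMultiple? a ⊎-dec nonzeroMultiple? (p ^ 2) a) (allFin n)
        ≡⟨ count-≐ _ (nonzeroMultiple? p)
             ( [ exactMultiple⇒nonzeroMultiple , p²-multiple⇒p-multiple ]′
             , vertex⇒Q⊎K ∘ p-multiple⇒vertex)
             (allFin n) ⟩
      count (nonzeroMultiple? p) (allFin n)
        ≡⟨ count-p-multiple ⟩
      ℕ.pred (p ^ 2)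
        ∎

  -- Since p is positive, the predecessor counted in the naturals agrees with subtraction in the
  -- integers.
  +pred : + ℕ.pred p ≡ + p - 1ℤ
  +pred = begin
    + ℕ.pred p                  ≡⟨ ℤ.pred-suc (+ ℕ.pred p) ⟨
    ℤ.-1ℤ ℤ.+ + suc (ℕ.pred p)  ≡⟨ cong (λ m → ℤ.-1ℤ ℤ.+ + m) (ℕ.suc-pred p) ⟩
    ℤ.-1ℤ ℤ.+ + p               ≡⟨ ℤ.+-comm ℤ.-1ℤ (+ p) ⟩
    + p - 1ℤ                    ∎

-- The independence polynomial of Γ(ℤ_{p³})

proposition2p1 : ∀ (p : ℕ) (p-prime : Prime p) →
    let I = independencePolynomial (Γ (p ^ 3) {{m^n≢0 p 3 {{prime⇒nonZero p-prime}}}})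
        A = (𝟙 ⊕ X) ↑ (p ^ 2 ∸ p)
        B = const (+ p - 1ℤ) ⊗ X
    in (I ≈ A ⊕ (𝟙 ⊕ B) ⊖ 𝟙)
     × (A ⊕ (𝟙 ⊕ B) ⊖ 𝟙 ≈ A ⊕ B)
-- The shorter form is proved first; the longer one follows by cancelling the constant 1 in each
-- coefficient.
proposition2p1 p p-prime = (λ k → trans (I≈A⊕B k) (sym (simplify k))) , simplify
  where
  I = independencePolynomial (Γ (p ^ 3) {{m^n≢0 p 3 {{prime⇒nonZero p-prime}}}})
  A = (𝟙 ⊕ X) ↑ (p ^ 2 ∸ p)
  B = const (+ p - 1ℤ) ⊗ X

  I≈A⊕B : I ≈ A ⊕ B
  I≈A⊕B k = begin
    coeff I k
      ≡⟨ completeSplit-independencePolynomial (exactMultiple? p-prime)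
           (nonzeroMultiple? (p ^ 2)) (Γ[p³]-completeSplit p-prime) k ⟩
    coeff ((𝟙 ⊕ X) ↑ count (exactMultiple? p-prime) (allFin (p ^ 3))
           ⊕ const (+ count (nonzeroMultiple? (p ^ 2)) (allFin (p ^ 3))) ⊗ X) k
      ≡⟨ cong₂ (λ q b → coeff ((𝟙 ⊕ X) ↑ q ⊕ const b ⊗ X) k)
           (count-exactMultiple p-prime)
           (trans (cong +_ (count-p²-multiple p-prime)) (+pred p-prime)) ⟩
    coeff (A ⊕ B) k
      ∎

  simplify : A ⊕ (𝟙 ⊕ B) ⊖ 𝟙 ≈ A ⊕ B
  simplify k = begin
    coeff (A ⊕ (𝟙 ⊕ B) ⊖ 𝟙) k
      ≡⟨ coeff-⊕ (A ⊕ (𝟙 ⊕ B)) (map ℤ.-_ 𝟙) k ⟩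
    coeff (A ⊕ (𝟙 ⊕ B)) k ℤ.+ coeff (map ℤ.-_ 𝟙) k
      ≡⟨ cong₂ ℤ._+_
           (trans (coeff-⊕ A (𝟙 ⊕ B) k) (cong (λ c → coeff A k ℤ.+ c) (coeff-⊕ 𝟙 B k)))
           (coeff-map ℤ.-_ refl 𝟙 k) ⟩
    coeff A k ℤ.+ (coeff 𝟙 k ℤ.+ coeff B k) ℤ.+ ℤ.- coeff 𝟙 k
      ≡⟨ cancel (coeff A k) (coeff 𝟙 k) (coeff B k) ⟩
    coeff A k ℤ.+ coeff B k
      ≡⟨ coeff-⊕ A B k ⟨
    coeff (A ⊕ B) k
      ∎
    where
    cancel : ∀ a o b → a ℤ.+ (o ℤ.+ b) ℤ.+ ℤ.- o ≡ a ℤ.+ b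
    cancel = ℤ-Solver.solve-∀
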